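{- There exist at least two distinct families of pairs $(A_p,B_p)$, each indexed by all primes $p\ge 11$, such that for every prime $p\ge 11$ the sets $A_p,B_p\subset\mathbb{Z}_p$ are not arithmetic progressions, $|A_p|+|B_p|=p$, and $$|A_p\widehat{+}B_p|=p-2.$$
   Context: $\mathbb{Z}_p=\mathbb{Z}/p\mathbb{Z}$ is the cyclic group of order $p$. For nonempty $A,B\subset\mathbb{Z}_p$, the restricted sumset is $A\widehat{+}B=\{a+b: a\in A,\ b\in B,\ a\neq b\}$. A subset of $\mathbb{Z}_p$ of size $m$ is an arithmetic progression if it has the form $\{a_0+id: 0\le i\le m-1\}$ for some $a_0,d\in\mathbb{Z}_p$ with $d\neq 0$. -}

module Defs where

open import Data.Fin.Base using (Fin; toℕ)
open import Data.Fin.Properties using (_≟_; any?; nonZeroIndex)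
open import Data.Fin.Subset using (Subset; _∈_; ∣_∣)
open import Data.Fin.Subset.Properties using (_∈?_)
open import Data.Nat.Base using (ℕ; _+_; _*_; _∸_; _<_; _≤_)
open import Data.Nat.DivMod using (_mod_)
open import Data.Nat.Primality using (Prime)
open import Data.Product.Base using (∃-syntax; _×_; _,_)
open import Data.Vec.Base using (tabulate)
open import Function.Bundles using (_⇔_)
open import Relation.Binary.PropositionalEquality.Core using (_≡_; _≢_)
open import Relation.Nullary.Decidable using (Dec; does; _×-dec_; ¬?)
open import Relation.Nullary.Negation.Core using (¬_)

-- ℤ/pℤ is represented by Fin p, each class by its least residue.

infixl 6 _+ₚ_
infixl 7 _·ₚ_

_+ₚ_ : ∀ {p} → Fin p → Fin p → Fin p
_+ₚ_ {p} a b = _mod_ (toℕ a + toℕ b) p {{nonZeroIndex a}}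

_·ₚ_ : ∀ {p} → ℕ → Fin p → Fin p
_·ₚ_ {p} i d = _mod_ (i * toℕ d) p {{nonZeroIndex d}}

IsRestrictedSum : ∀ {p} → Subset p → Subset p → Fin p → Set
IsRestrictedSum A B c = ∃[ a ] ∃[ b ] (a ∈ A × b ∈ B × a ≢ b × c ≡ a +ₚ b)

isRestrictedSum? : ∀ {p} (A B : Subset p) (c : Fin p) → Dec (IsRestrictedSum A B c)
isRestrictedSum? A B c = any? λ a → any? λ b →
  (a ∈? A) ×-dec (b ∈? B) ×-dec ¬? (a ≟ b) ×-dec (c ≟ a +ₚ b)

infixl 6 _+̂_

_+̂_ : ∀ {p} → Subset p → Subset p → Subset p
A +̂ B = tabulate λ c → does (isRestrictedSum? A B c)

-- Size 0 is allowed, so the empty set counts as an arithmetic progression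
-- (for p ≥ 2); a set that is not a progression is therefore nonempty.
IsAP : ∀ {p} → Subset p → Set
IsAP {p} A = ∃[ a₀ ] ∃[ d ] (toℕ d ≢ 0 ×
  (∀ (x : Fin p) → x ∈ A ⇔ (∃[ i ] (i < ∣ A ∣ × x ≡ a₀ +ₚ i ·ₚ d))))

IsExtremalPair : ∀ {p} → Subset p × Subset p → Set
IsExtremalPair {p} (A , B) =
  ¬ IsAP A × ¬ IsAP B × ∣ A ∣ + ∣ B ∣ ≡ p × ∣ A +̂ B ∣ ≡ p ∸ 2

-- The proof arguments are irrelevant, so the pair depends on p alone.
Family : Set
Family = (p : ℕ) → .(Prime p) → .(11 ≤ p) → Subset p × Subset p

{-# OPTIONS --safe #-}

-- For A of size k and B the complement of a k-set C, a class c is missed by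
-- A +̂ B exactly when c − a ∈ C for every a ∈ A other than c/2.  Prescribing
-- two missed classes, and rescaling so that they become 6 and 8, leads to
-- A = {3,4,6}, C = {0,2,5} and to A = {1,3,4,6}, C = {0,2,5,7}.  In both cases
-- every remaining class is already the sum of 3 or 4 and an element of B.
--
-- A progression S of difference d contains at most one x with x + d ∉ S, and
-- if B is a progression of difference d, then C contains at most one x with
-- x − d ∉ C.  For sets of residues below 8 these conditions depend only on
-- d and p − d, both capped at 12, so that finitely many cases refute them.

module Submission where

open import Defs
open import Data.Fin.Base using (Fin; toℕ; fromℕ<)
open import Data.Fin.Properties using (toℕ<n; toℕ-fromℕ<; toℕ-injective; nonZeroIndex)
open import Data.Fin.Subset using (Subset; _∈_; _∉_; ∁; ∣_∣)
open import Data.Fin.Subset.Properties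
  using (x∈∁p⇒x∉p; x∉p⇒x∈∁p; ⊆-antisym; ∣∁p∣≡n∸∣p∣)
open import Data.List.Base using (List; []; _∷_)
open import Data.List.Relation.Unary.All as All using (All)
open import Data.List.Relation.Unary.Any as Any using (Any; here; there)
open import Data.List.Membership.Propositional using (find; lose)
open import Data.Nat.Base
  using (ℕ; zero; suc; _+_; _*_; _∸_; _%_; _⊓_; _<_; _≤_; NonZero; z≤n; s≤s)
open import Data.Nat.DivMod
  using (m<n⇒m%n≡m; m≤n⇒[n∸m]%m≡n%m; [m+n]%n≡m%n; m%n%n≡m%n; %-distribˡ-+)
open import Data.Nat.Primality using (Prime; prime?)
open import Data.Nat.Properties
open import Data.List.Membership.DecPropositional _≟_ using (_∈?_)
  renaming (_∈_ to _∈ₗ_; _∉_ to _∉ₗ_)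
open import Data.Product.Base using (Σ-syntax; ∃-syntax; _×_; _,_; proj₁)
open import Data.Sum.Base using (_⊎_; inj₁; inj₂)
open import Data.Unit.Base using (tt)
open import Data.Vec.Base using (tabulate)
open import Data.Vec.Properties using (lookup∘tabulate; lookup⇒[]=; []=⇒lookup)
open import Function.Base using (_∘_)
open import Function.Bundles using (module Equivalence)
open import Relation.Binary.PropositionalEquality.Core
  using (_≡_; _≢_; refl; sym; trans; cong; cong₂; subst)
open import Relation.Binary.PropositionalEquality.Properties using (module ≡-Reasoning)
open import Relation.Nullary.Decidable
  using (Dec; False; yes; no; does; _×-dec_; _⊎-dec_; _→-dec_; ¬?;
         toWitness; toWitnessFalse; dec-true)
open import Relation.Nullary.Negation.Core using (¬_; contradiction)
open import Relation.Unary using (Decidable)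

private
  variable
    p : ℕ

-- Subsets cut out by decidable predicates

module _ {P : Fin p → Set} (P? : Decidable P) where

  ∈-comprehension⁺ : ∀ {x} → P x → x ∈ tabulate (does ∘ P?)
  ∈-comprehension⁺ {x} Px = lookup⇒[]= x _ (trans (lookup∘tabulate _ x) (dec-true (P? x) Px))

  ∈-comprehension⁻ : ∀ {x} → x ∈ tabulate (does ∘ P?) → P x
  ∈-comprehension⁻ {x} x∈ with P? x | trans (sym (lookup∘tabulate (does ∘ P?) x)) ([]=⇒lookup x∈)
  ... | yes Px | _ = Px

residues : List ℕ → (p : ℕ) → Subset p
residues L p = tabulate λ x → does (toℕ x ∈? L)

∈-residues⁺ : ∀ L {x : Fin p} → toℕ x ∈ₗ L → x ∈ residues L p
∈-residues⁺ L = ∈-comprehension⁺ (λ x → toℕ x ∈? L)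

∈-residues⁻ : ∀ L {x : Fin p} → x ∈ residues L p → toℕ x ∈ₗ L
∈-residues⁻ L = ∈-comprehension⁻ (λ x → toℕ x ∈? L)

-- Addition modulo p

toℕ-+ₚ : .{{_ : NonZero p}} (x y : Fin p) → toℕ (x +ₚ y) ≡ (toℕ x + toℕ y) % p
toℕ-+ₚ x y = toℕ-fromℕ< _

-- Two least residues add up to less than 2p, so reduction subtracts p at most once. Equations
-- modulo p thus become equations between natural numbers.
+ₚ-elim : (x y : Fin p) → toℕ x + toℕ y ≡ toℕ (x +ₚ y) ⊎ toℕ x + toℕ y ≡ toℕ (x +ₚ y) + p
+ₚ-elim {p} x y with toℕ x + toℕ y <? p
... | yes s<p = inj₁ (sym (trans (toℕ-+ₚ x y) (m<n⇒m%n≡m s<p)))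
  where instance _ = nonZeroIndex x
... | no  s≮p = inj₂ (begin
  s                    ≡⟨ m∸n+n≡m p≤s ⟨
  s ∸ p + p            ≡⟨ cong (_+ p) (m<n⇒m%n≡m s∸p<p) ⟨
  (s ∸ p) % p + p      ≡⟨ cong (_+ p) (m≤n⇒[n∸m]%m≡n%m p≤s) ⟩
  s % p + p            ≡⟨ cong (_+ p) (toℕ-+ₚ x y) ⟨
  toℕ (x +ₚ y) + p     ∎)
  where
  open ≡-Reasoning
  instance _ = nonZeroIndex x
  s = toℕ x + toℕ y
  p≤s = ≮⇒≥ s≮p
  s∸p<p : s ∸ p < p
  s∸p<p = subst (s ∸ p <_) (m+n∸n≡m p p) (∸-monoˡ-< (+-mono-< (toℕ<n x) (toℕ<n y)) p≤s)

+ₚ-intro : (x y z : Fin p) →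
  toℕ x + toℕ y ≡ toℕ z ⊎ toℕ x + toℕ y ≡ toℕ z + p → z ≡ x +ₚ y
+ₚ-intro {p} x y z eq = toℕ-injective (sym (trans (toℕ-+ₚ x y) (reduce eq)))
  where
  instance _ = nonZeroIndex x
  reduce : toℕ x + toℕ y ≡ toℕ z ⊎ toℕ x + toℕ y ≡ toℕ z + p → (toℕ x + toℕ y) % p ≡ toℕ z
  reduce (inj₁ eq) = trans (cong (_% p) eq) (m<n⇒m%n≡m (toℕ<n z))
  reduce (inj₂ eq) = trans (cong (_% p) eq) (trans ([m+n]%n≡m%n (toℕ z) p) (m<n⇒m%n≡m (toℕ<n z)))

%-+ˡ : ∀ m n d .{{_ : NonZero d}} → (m % d + n) % d ≡ (m + n) % d
%-+ˡ m n d = begin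
  (m % d + n) % d          ≡⟨ %-distribˡ-+ (m % d) n d ⟩
  (m % d % d + n % d) % d  ≡⟨ cong (λ k → (k + n % d) % d) (m%n%n≡m%n m d) ⟩
  (m % d + n % d) % d      ≡⟨ %-distribˡ-+ m n d ⟨
  (m + n) % d              ∎
  where open ≡-Reasoning

toℕ-term : .{{_ : NonZero p}} (a d : Fin p) (i : ℕ) →
  toℕ (a +ₚ i ·ₚ d) ≡ (i * toℕ d + toℕ a) % p
toℕ-term {p} a d i = begin
  toℕ (a +ₚ i ·ₚ d)                  ≡⟨ toℕ-+ₚ a (i ·ₚ d) ⟩
  (toℕ a + toℕ (i ·ₚ d)) % p         ≡⟨ cong (λ k → (toℕ a + k) % p) (toℕ-fromℕ< _) ⟩
  (toℕ a + (i * toℕ d) % p) % p      ≡⟨ cong (_% p) (+-comm (toℕ a) _) ⟩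
  ((i * toℕ d) % p + toℕ a) % p      ≡⟨ %-+ˡ (i * toℕ d) (toℕ a) p ⟩
  (i * toℕ d + toℕ a) % p            ∎
  where open ≡-Reasoning

next-term : (a d : Fin p) (i : ℕ) → a +ₚ i ·ₚ d +ₚ d ≡ a +ₚ suc i ·ₚ d
next-term {p} a d i = toℕ-injective (begin
  toℕ (a +ₚ i ·ₚ d +ₚ d)                     ≡⟨ toℕ-+ₚ (a +ₚ i ·ₚ d) d ⟩
  (toℕ (a +ₚ i ·ₚ d) + toℕ d) % p            ≡⟨ cong (λ k → (k + toℕ d) % p) (toℕ-term a d i) ⟩
  ((i * toℕ d + toℕ a) % p + toℕ d) % p      ≡⟨ %-+ˡ (i * toℕ d + toℕ a) (toℕ d) p ⟩
  (i * toℕ d + toℕ a + toℕ d) % p            ≡⟨ cong (_% p) (+-comm _ (toℕ d)) ⟩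
  (toℕ d + (i * toℕ d + toℕ a)) % p          ≡⟨ cong (_% p) (+-assoc (toℕ d) _ _) ⟨
  (suc i * toℕ d + toℕ a) % p                ≡⟨ toℕ-term a d (suc i) ⟨
  toℕ (a +ₚ suc i ·ₚ d)                      ∎)
  where
  open ≡-Reasoning
  instance _ = nonZeroIndex a

-- Arithmetic progressions are almost invariant under translation

AlmostInvariant : Subset p → Fin p → Set
AlmostInvariant S d = ∀ {x y} → x ∈ S → y ∈ S → x +ₚ d ∉ S → y +ₚ d ∉ S → x ≡ y

-- A term of index i is followed by the term of index i + 1, so it can leave `S` only if i + 1 =
-- `∣ S ∣`. All elements that leave therefore share one index.
AP⇒almostInvariant : (S : Subset p) → IsAP S → ∃[ d ] (toℕ d ≢ 0 × AlmostInvariant S d)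
AP⇒almostInvariant S (a , d , d≢0 , S⇔) = d , d≢0 , almost
  where
  last-index : ∀ {x} → x ∈ S → x +ₚ d ∉ S → ∃[ i ] (suc i ≡ ∣ S ∣ × x ≡ a +ₚ i ·ₚ d)
  last-index {x} x∈S x+d∉S with Equivalence.to (S⇔ x) x∈S
  ... | i , i<k , refl with suc i <? ∣ S ∣
  ... | yes 1+i<k = contradiction (Equivalence.from (S⇔ _) (suc i , 1+i<k , next-term a d i)) x+d∉S
  ... | no  1+i≮k = i , ≤-antisym i<k (≮⇒≥ 1+i≮k) , refl

  almost : AlmostInvariant S d
  almost x∈S y∈S x+d∉S y+d∉S with last-index x∈S x+d∉S | last-index y∈S y+d∉S
  ... | i , 1+i≡k , refl | j , 1+j≡k , refl =
    cong (λ i → a +ₚ i ·ₚ d) (suc-injective (trans 1+i≡k (sym 1+j≡k)))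

negate : (d : Fin p) → toℕ d ≢ 0 → ∃[ e ] (toℕ e ≢ 0 × toℕ e + toℕ d ≡ p)
negate {p} d d≢0 = fromℕ< p∸d<p , m>n⇒m∸n≢0 (toℕ<n d) ∘ trans (sym toℕ-e) ,
  trans (cong (_+ toℕ d) toℕ-e) (m∸n+n≡m (<⇒≤ (toℕ<n d)))
  where
  p∸d<p : p ∸ toℕ d < p
  p∸d<p = ∸-monoʳ-< (n≢0⇒n>0 d≢0) (<⇒≤ (toℕ<n d))
  toℕ-e = toℕ-fromℕ< p∸d<p

-ₚ-cancel : (e d : Fin p) → toℕ e + toℕ d ≡ p → ∀ z → z +ₚ e +ₚ d ≡ z
-ₚ-cancel {p} e d e+d≡p z = sym (+ₚ-intro (z +ₚ e) d z (shift (+ₚ-elim z e)))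
  where
  z+e+d : toℕ z + toℕ e + toℕ d ≡ toℕ z + p
  z+e+d = trans (+-assoc (toℕ z) _ _) (cong (toℕ z +_) e+d≡p)
  swap : ∀ a b c → a + b + c ≡ a + c + b
  swap a b c = trans (+-assoc a b c) (trans (cong (a +_) (+-comm b c)) (sym (+-assoc a c b)))
  shift : ∀ {s} → toℕ z + toℕ e ≡ s ⊎ toℕ z + toℕ e ≡ s + p →
          s + toℕ d ≡ toℕ z ⊎ s + toℕ d ≡ toℕ z + p
  shift (inj₁ refl) = inj₂ z+e+d
  shift {s} (inj₂ eq) = inj₁ (+-cancelʳ-≡ p _ _
    (trans (swap s (toℕ d) p) (trans (cong (_+ toℕ d) (sym eq)) z+e+d)))

+ₚ-cancelʳ : (x y e : Fin p) → x +ₚ e ≡ y +ₚ e → toℕ e ≢ 0 → x ≡ y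
+ₚ-cancelʳ x y e eq e≢0 with negate e e≢0
... | f , _ , f+e≡p = trans (sym (cancel x)) (trans (cong (_+ₚ f) eq) (cancel y))
  where cancel = -ₚ-cancel e f (trans (+-comm (toℕ e) _) f+e≡p)

-- Let d be the difference of the progression and e = -d. If x in `S` leaves `S` under e, then x + e
-- lies in `∁ S`, and adding d returns it to x, outside `∁ S`. At most one x + e does that.
∁-AP⇒almostInvariant : (S : Subset p) → IsAP (∁ S) → ∃[ d ] (toℕ d ≢ 0 × AlmostInvariant S d)
∁-AP⇒almostInvariant S ap with AP⇒almostInvariant (∁ S) ap
... | d , d≢0 , almost with negate d d≢0
... | e , e≢0 , e+d≡p = e , e≢0 , λ {x} {y} x∈S y∈S x+e∉S y+e∉S →
  +ₚ-cancelʳ x y e (almost (x∉p⇒x∈∁p x+e∉S) (x∉p⇒x∈∁p y+e∉S) (back x x∈S) (back y y∈S)) e≢0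
  where
  back : ∀ x → x ∈ S → x +ₚ e +ₚ d ∉ ∁ S
  back x x∈S x+e+d∈∁S = x∈∁p⇒x∉p x+e+d∈∁S (subst (_∈ S) (sym (-ₚ-cancel e d e+d≡p x)) x∈S)

-- Refuting almost invariance by finitely many cases

-- With e = p − d, the condition x + d ∈ L modulo p says that x + d = z or
-- z + e = x for some z ∈ L.
Stays : List ℕ → ℕ → ℕ → ℕ → Set
Stays L d e x = Any (λ z → x + d ≡ z ⊎ z + e ≡ x) L

TwoExits : List ℕ → ℕ → ℕ → Set
TwoExits L d e = Any (λ x → Any (λ y → x ≢ y × ¬ Stays L d e x × ¬ Stays L d e y) L) L

-- The bounds on d and e suffice because residues below 12 do not distinguish
-- the steps d, e from d ⊓ 12, e ⊓ 12.  The sum 12 is excluded since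
-- {0,2,5,7} is a progression of difference 7 modulo 12.
Scattered : List ℕ → Set
Scattered L = ∀ {d} → d < 13 → ∀ {e} → e < 13 →
  1 ≤ d → 1 ≤ e → 11 ≤ d + e → d + e ≢ 12 → TwoExits L d e

stays? : ∀ L d e x → Dec (Stays L d e x)
stays? L d e x = Any.any? (λ z → (x + d ≟ z) ⊎-dec (z + e ≟ x)) L

twoExits? : ∀ L d e → Dec (TwoExits L d e)
twoExits? L d e = Any.any? (λ x → Any.any? (λ y →
  ¬? (x ≟ y) ×-dec ¬? (stays? L d e x) ×-dec ¬? (stays? L d e y)) L) L

scattered? : ∀ L → Dec (Scattered L)
scattered? L = allUpTo? (λ d → allUpTo? (λ e →
  (1 ≤? d) →-dec (1 ≤? e) →-dec (11 ≤? d + e) →-dec ¬? (d + e ≟ 12) →-dec twoExits? L d e) 13) 13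

⊓-step : ∀ x d {z b} → z < b → x + d ≡ z → x + d ⊓ b ≡ z
⊓-step x d z<b refl = cong (x +_) (m≤n⇒m⊓n≡m (≤-trans (m≤n+m d x) (<⇒≤ z<b)))

-- A step that joins two residues below 12 is itself below 12, so capping leaves it alone. By
-- contraposition, exits found for the capped steps are exits for the true ones.
clip-stays : ∀ {L} d e {x} → All (_< 12) L → x ∈ₗ L → Stays L d e x → Stays L (d ⊓ 12) (e ⊓ 12) x
clip-stays d e {x} L<12 x∈L stays with find stays
... | z , z∈L , inj₁ eq = lose z∈L (inj₁ (⊓-step x d (All.lookup L<12 z∈L) eq))
... | z , z∈L , inj₂ eq = lose z∈L (inj₂ (⊓-step z e (All.lookup L<12 x∈L) eq))

1≤⊓12 : ∀ {d} → 1 ≤ d → 1 ≤ d ⊓ 12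
1≤⊓12 1≤d = ⊓-glb 1≤d (s≤s z≤n)

-- If both steps are below 12, nothing changes. Otherwise one is capped to exactly 12 and the other
-- stays positive, so the sum exceeds 12.
clip-sum : ∀ d e → 1 ≤ d → 1 ≤ e → 11 ≤ d + e → d + e ≢ 12 →
  11 ≤ d ⊓ 12 + e ⊓ 12 × d ⊓ 12 + e ⊓ 12 ≢ 12
clip-sum d e 1≤d 1≤e 11≤d+e d+e≢12 with <-≤-connex d 12 | <-≤-connex e 12
... | inj₁ d<12 | inj₁ e<12
  rewrite m≤n⇒m⊓n≡m (<⇒≤ d<12) | m≤n⇒m⊓n≡m (<⇒≤ e<12) = 11≤d+e , d+e≢12
... | inj₂ 12≤d | _ rewrite m≥n⇒m⊓n≡n 12≤d =
  ≤-trans (n≤1+n 11) (m≤m+n 12 _) , λ eq → <⇒≢ (+-monoʳ-≤ 12 (1≤⊓12 1≤e)) (sym eq)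
... | inj₁ _ | inj₂ 12≤e rewrite m≥n⇒m⊓n≡n 12≤e =
  ≤-trans (n≤1+n 11) (m≤n+m 12 _) , λ eq → <⇒≢ (+-monoˡ-≤ 12 (1≤⊓12 1≤d)) (sym eq)

-- The finite check at the capped steps d and p - d yields two distinct entries that leave, and
-- almost invariance would identify them. Entries below 11 ≤ p are their own least residues.
scattered⇒¬almostInvariant : ∀ {L} → Scattered L → All (_< 11) L → 11 ≤ p → p ≢ 12 →
  (d : Fin p) → toℕ d ≢ 0 → ¬ AlmostInvariant (residues L p) d
scattered⇒¬almostInvariant {p} {L} scat L<11 11≤p p≢12 d d≢0 almost
  with negate d d≢0
... | e , e≢0 , e+d≡p
  with d+e≡p ← trans (+-comm (toℕ d) _) e+d≡p
  with 1≤d ← n≢0⇒n>0 d≢0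
  with 1≤e ← n≢0⇒n>0 e≢0
  with 11≤ , ≢12 ← clip-sum (toℕ d) (toℕ e) 1≤d 1≤e
         (subst (11 ≤_) (sym d+e≡p) 11≤p) (p≢12 ∘ trans (sym d+e≡p))
  with find (scat (s≤s (m⊓n≤n (toℕ d) 12)) (s≤s (m⊓n≤n (toℕ e) 12))
                  (1≤⊓12 1≤d) (1≤⊓12 1≤e) 11≤ ≢12)
... | x , x∈L , any-y with find any-y
... | y , y∈L , x≢y , x-exits , y-exits =
  x≢y (trans (sym (toℕ-res x∈L)) (trans (cong toℕ x≡y) (toℕ-res y∈L)))
  where
  res : ∀ {x} → x ∈ₗ L → Fin p
  res x∈L = fromℕ< (<-≤-trans (All.lookup L<11 x∈L) 11≤p)
  toℕ-res : ∀ {x} (x∈L : x ∈ₗ L) → toℕ (res x∈L) ≡ x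
  toℕ-res x∈L = toℕ-fromℕ< (<-≤-trans (All.lookup L<11 x∈L) 11≤p)
  res∈ : ∀ {x} (x∈L : x ∈ₗ L) → res x∈L ∈ residues L p
  res∈ x∈L = ∈-residues⁺ L (subst (_∈ₗ L) (sym (toℕ-res x∈L)) x∈L)
  wrap : ∀ {s z} → s + toℕ d ≡ z + p → z + toℕ e ≡ s
  wrap {s} {z} eq = +-cancelʳ-≡ (toℕ d) _ _
    (trans (+-assoc z _ _) (trans (cong (z +_) e+d≡p) (sym eq)))
  stays : ∀ {x} (x∈L : x ∈ₗ L) → res x∈L +ₚ d ∈ residues L p → Stays L (toℕ d) (toℕ e) x
  stays {x} x∈L r∈ with ∈-residues⁻ L r∈ | +ₚ-elim (res x∈L) d
  ... | z∈L | inj₁ eq = lose z∈L (inj₁ (trans (cong (_+ toℕ d) (sym (toℕ-res x∈L))) eq))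
  ... | z∈L | inj₂ eq = lose z∈L (inj₂ (trans (wrap eq) (toℕ-res x∈L)))
  exits : ∀ {x} (x∈L : x ∈ₗ L) → ¬ Stays L (toℕ d ⊓ 12) (toℕ e ⊓ 12) x → res x∈L +ₚ d ∉ residues L p
  exits x∈L ¬stays = ¬stays ∘ clip-stays (toℕ d) (toℕ e) (All.map m<n⇒m<1+n L<11) x∈L ∘ stays x∈L
  x≡y : res x∈L ≡ res y∈L
  x≡y = almost (res∈ x∈L) (res∈ y∈L) (exits x∈L x-exits) (exits y∈L y-exits)

-- The restricted sumset

missing : List ℕ
missing = 6 ∷ 8 ∷ []

-- The only partner of a for the sum s is s - a, which must be a itself, hence forbidden, or lie in
-- `C`. The bound a ≤ s makes the truncated subtraction exact and excludes wraparound.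
Blocks : List ℕ → List ℕ → Set
Blocks A C = All (λ s → All (λ a → a ≤ s × (a + a ≡ s ⊎ s ∸ a ∈ₗ C)) A) missing

blocks? : ∀ A C → Dec (Blocks A C)
blocks? A C = All.all? (λ s → All.all? (λ a → (a ≤? s) ×-dec ((a + a ≟ s) ⊎-dec (s ∸ a ∈? C))) A) missing

summand : ∀ {a b c} → a ≤ c → b < p → a + b ≡ c ⊎ a + b ≡ c + p → b ≡ c ∸ a
summand {a = a} {b} a≤c b<p (inj₁ refl) = sym (m+n∸m≡n a b)
summand {a = a} a≤c b<p (inj₂ eq) = contradiction eq (<⇒≢ (+-mono-≤-< a≤c b<p))

blocked : ∀ A C → Blocks A C → ∀ {c} → c ∈ residues missing p →
  ¬ IsRestrictedSum (residues A p) (∁ (residues C p)) c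
blocked A C blocks c∈M (a , b , a∈A , b∈B , a≢b , refl)
  with All.lookup (All.lookup blocks (∈-residues⁻ missing c∈M)) (∈-residues⁻ A a∈A)
... | a≤c , blocker with summand a≤c (toℕ<n b) (+ₚ-elim a b) | blocker
... | b≡c∸a | inj₁ 2a≡c = a≢b (toℕ-injective (sym
        (trans b≡c∸a (trans (cong (_∸ toℕ a) (sym 2a≡c)) (m+n∸m≡n (toℕ a) _)))))
... | b≡c∸a | inj₂ c∸a∈C = x∈∁p⇒x∉p b∈B (∈-residues⁺ C (subst (_∈ₗ C) (sym b≡c∸a) c∸a∈C))

C₄ : List ℕ
C₄ = 0 ∷ 2 ∷ 5 ∷ 7 ∷ []

-- One table serves both families: 3 and 4 lie in both sets A, and `C₄` contains the other C. With
-- `False`, the avoidance of `C₄` holds by computation even for b = 8 + m with m a variable.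
record Summands (p c : ℕ) : Set where
  constructor summands
  field
    a b : ℕ
    a∈ : a ∈ₗ 3 ∷ 4 ∷ []
    b<p : b < p
    b∉ : False (b ∈? C₄)
    a≢b : a ≢ b
    sum : a + b ≡ c ⊎ a + b ≡ c + p

-- The summand 3 works unless c - 3 is 3 or lies in `C₄`, that is, unless c is 6 or one of 3, 5, 8,
-- 10. Of these, 4 handles 3, 5 and 10.
covered : ∀ m c → c < 11 + m → c ∉ₗ missing → Summands (11 + m) c
-- For p = 11 + m, the residues p - 3, p - 2, p - 1 are at least 8 and so avoid `C₄`.
covered m 0 _ _ = summands 3 (8 + m) (here refl) (m≤n+m (9 + m) 2) tt (λ ()) (inj₂ refl)
covered m 1 _ _ = summands 3 (9 + m) (here refl) (m≤n+m (10 + m) 1) tt (λ ()) (inj₂ refl)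
covered m 2 _ _ = summands 3 (10 + m) (here refl) (m≤n+m (11 + m) 0) tt (λ ()) (inj₂ refl)
covered m 3 _ _ = summands 4 (10 + m) (there (here refl)) (m≤n+m (11 + m) 0) tt (λ ()) (inj₂ refl)
covered m 4 _ _ = summands 3 1 (here refl) (s≤s (s≤s z≤n)) tt (λ ()) (inj₁ refl)
covered m 5 _ _ = summands 4 1 (there (here refl)) (s≤s (s≤s z≤n)) tt (λ ()) (inj₁ refl)
covered m 6 _ c∉ = contradiction (here refl) c∉
covered m 7 _ _ = summands 3 4 (here refl) (m≤m+n 5 _) tt (λ ()) (inj₁ refl)
covered m 8 _ c∉ = contradiction (there (here refl)) c∉
covered m 9 _ _ = summands 3 6 (here refl) (m≤m+n 7 _) tt (λ ()) (inj₁ refl)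
covered m 10 _ _ = summands 4 6 (there (here refl)) (m≤m+n 7 _) tt (λ ()) (inj₁ refl)
covered m (suc (suc (suc (suc (suc (suc (suc (suc (suc (suc (suc c))))))))))) c<p _ =
  summands 3 (8 + c) (here refl) (≤-trans (m≤n+m _ 3) c<p) tt (λ ()) (inj₁ refl)

covers : ∀ {A C} → 11 ≤ p → All (_∈ₗ A) (3 ∷ 4 ∷ []) → All (_∈ₗ C₄) C →
  ∀ {c} → c ∉ residues missing p → IsRestrictedSum (residues A p) (∁ (residues C p)) c
covers {A = A} {C} 11≤p ⊆A C⊆ {c} c∉ with m , refl ← m≤n⇒∃[o]m+o≡n 11≤p =
  let summands a b a∈ b<p b∉ a≢b sum = covered m (toℕ c) (toℕ<n c) (c∉ ∘ ∈-residues⁺ missing)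
      a<p = <-≤-trans (All.lookup (toWitness {a? = All.all? (_<? 11) (3 ∷ 4 ∷ [])} tt) a∈) 11≤p
      toℕ-a = toℕ-fromℕ< a<p
      toℕ-b = toℕ-fromℕ< b<p
  in fromℕ< a<p , fromℕ< b<p
   , ∈-residues⁺ A (subst (_∈ₗ A) (sym toℕ-a) (All.lookup ⊆A a∈))
   , x∉p⇒x∈∁p (λ b∈C → toWitnessFalse b∉ (subst (_∈ₗ C₄) toℕ-b (All.lookup C⊆ (∈-residues⁻ C b∈C))))
   , (λ a≡b → a≢b (trans (sym toℕ-a) (trans (cong toℕ a≡b) toℕ-b)))
   , +ₚ-intro (fromℕ< a<p) (fromℕ< b<p) c
       (subst (λ s → s ≡ toℕ c ⊎ s ≡ toℕ c + (11 + m)) (sym (cong₂ _+_ toℕ-a toℕ-b)) sum)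

∣residues-[]∣≡0 : ∀ m → ∣ residues [] m ∣ ≡ 0
∣residues-[]∣≡0 zero    = refl
∣residues-[]∣≡0 (suc m) = ∣residues-[]∣≡0 m

-- If the entries of a concrete `L` are below 11, the first 11 positions compute and all later ones
-- reduce to false, so `refl` proves the hypothesis.
∣residues∣ : ∀ L {k} → (∀ m → ∣ residues L (11 + m) ∣ ≡ k + ∣ residues [] m ∣) →
  11 ≤ p → ∣ residues L p ∣ ≡ k
∣residues∣ L {k} size 11≤p with m , refl ← m≤n⇒∃[o]m+o≡n 11≤p =
  trans (size m) (trans (cong (k +_) (∣residues-[]∣≡0 m)) (+-identityʳ k))

-- Extremal pairs and the two families

record Admissible (A C : List ℕ) : Set where
  field
    A<11        : All (_< 11) A
    C<11        : All (_< 11) C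
    A-scattered : Scattered A
    C-scattered : Scattered C
    blocks      : Blocks A C
    3,4∈A       : All (_∈ₗ A) (3 ∷ 4 ∷ [])
    C⊆C₄        : All (_∈ₗ C₄) C

pair : List ℕ → List ℕ → (p : ℕ) → Subset p × Subset p
pair A C p = residues A p , ∁ (residues C p)

module _ {A C : List ℕ} (admissible : Admissible A C) (11≤p : 11 ≤ p) where
  open Admissible admissible

  sumset≡∁missing : residues A p +̂ ∁ (residues C p) ≡ ∁ (residues missing p)
  sumset≡∁missing = ⊆-antisym
    (λ c∈ → x∉p⇒x∈∁p λ c∈M → blocked A C blocks c∈M (∈-comprehension⁻ restricted? c∈))
    (λ c∈ → ∈-comprehension⁺ restricted? (covers 11≤p 3,4∈A C⊆C₄ (x∈∁p⇒x∉p c∈)))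
    where restricted? = isRestrictedSum? (residues A p) (∁ (residues C p))

  extremal : p ≢ 12 → ∀ {k} → k ≤ 11 → ∣ residues A p ∣ ≡ k → ∣ residues C p ∣ ≡ k →
    IsExtremalPair (pair A C p)
  extremal p≢12 {k} k≤11 ∣A∣≡k ∣C∣≡k =
      (λ ap → let d , d≢0 , almost = AP⇒almostInvariant (residues A p) ap
              in scattered⇒¬almostInvariant A-scattered A<11 11≤p p≢12 d d≢0 almost)
    , (λ ap → let d , d≢0 , almost = ∁-AP⇒almostInvariant (residues C p) ap
              in scattered⇒¬almostInvariant C-scattered C<11 11≤p p≢12 d d≢0 almost)
    , trans (cong₂ _+_ ∣A∣≡k (trans (∣∁p∣≡n∸∣p∣ (residues C p)) (cong (p ∸_) ∣C∣≡k)))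
        (m+[n∸m]≡n (≤-trans k≤11 11≤p))
    , trans (cong ∣_∣ sumset≡∁missing)
        (trans (∣∁p∣≡n∸∣p∣ (residues missing p))
          (cong (p ∸_) (∣residues∣ missing (λ _ → refl) 11≤p)))

A₃ A₄ C₃ : List ℕ
A₃ = 3 ∷ 4 ∷ 6 ∷ []
A₄ = 1 ∷ 3 ∷ 4 ∷ 6 ∷ []
C₃ = 0 ∷ 2 ∷ 5 ∷ []

admissible₃ : Admissible A₃ C₃
admissible₃ = record
  { A<11        = toWitness {a? = All.all? (_<? 11) A₃} tt
  ; C<11        = toWitness {a? = All.all? (_<? 11) C₃} tt
  ; A-scattered = toWitness {a? = scattered? A₃} tt
  ; C-scattered = toWitness {a? = scattered? C₃} tt
  ; blocks      = toWitness {a? = blocks? A₃ C₃} tt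
  ; 3,4∈A       = toWitness {a? = All.all? (_∈? A₃) (3 ∷ 4 ∷ [])} tt
  ; C⊆C₄        = toWitness {a? = All.all? (_∈? C₄) C₃} tt
  }

admissible₄ : Admissible A₄ C₄
admissible₄ = record
  { A<11        = toWitness {a? = All.all? (_<? 11) A₄} tt
  ; C<11        = toWitness {a? = All.all? (_<? 11) C₄} tt
  ; A-scattered = toWitness {a? = scattered? A₄} tt
  ; C-scattered = toWitness {a? = scattered? C₄} tt
  ; blocks      = toWitness {a? = blocks? A₄ C₄} tt
  ; 3,4∈A       = toWitness {a? = All.all? (_∈? A₄) (3 ∷ 4 ∷ [])} tt
  ; C⊆C₄        = toWitness {a? = All.all? (_∈? C₄) C₄} tt
  }

theoremB : Σ[ F ∈ Family ] Σ[ G ∈ Family ]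
    ((p : ℕ) (p-prime : Prime p) (11≤p : 11 ≤ p) →
    IsExtremalPair (F p p-prime 11≤p) ×
    IsExtremalPair (G p p-prime 11≤p) ×
    F p p-prime 11≤p ≢ G p p-prime 11≤p)
theoremB = (λ p _ _ → pair A₃ C₃ p) , (λ p _ _ → pair A₄ C₄ p) , λ p p-prime 11≤p →
  -- Primality excludes 12, the one modulus that `Scattered` leaves out.
  let p≢12 = λ p≡12 → toWitnessFalse {a? = prime? 12} tt (subst Prime p≡12 p-prime)
      ∣A₃∣≡3 = ∣residues∣ A₃ (λ _ → refl) 11≤p
      ∣A₄∣≡4 = ∣residues∣ A₄ (λ _ → refl) 11≤p
  in extremal admissible₃ 11≤p p≢12 (m≤m+n 3 8) ∣A₃∣≡3 (∣residues∣ C₃ (λ _ → refl) 11≤p)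
   , extremal admissible₄ 11≤p p≢12 (m≤m+n 4 7) ∣A₄∣≡4 (∣residues∣ C₄ (λ _ → refl) 11≤p)
   -- The families differ at every p, because their first sets have sizes 3 and 4.
   , λ F≡G → 1+n≢n (trans (sym ∣A₄∣≡4) (trans (cong (∣_∣ ∘ proj₁) (sym F≡G)) ∣A₃∣≡3))
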